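{- Let $G$ be a connected (finite, simple) graph with exactly $h$ holes. Suppose that all the holes in $G$ are pairwise edge-disjoint, that $G$ has at most one non-edge maximal clique, and that the clique number $\omega(G)$ equals $h+1$. Let $K$ be a clique of $G$ with $|V(K)|=\omega(G)$. Then there exists an acyclic digraph $D$ such that $C(D)=G\cup\{i_1,i_2\}$ (the graph $G$ together with two new isolated vertices $i_1,i_2$) and all the vertices of $K$ have $i_2$ as a common out-neighbor in $D$. In particular, $k(G)\le 2$.
   Context: A hole of a graph is a chordless cycle (a cycle that is an induced subgraph) of length at least $4$. A clique is a complete subgraph; a clique $K$ is non-edge if $|V(K)|\ge 3$; the clique number $\omega(G)$ is the maximum number of vertices of a clique of $G$. For a digraph $D=(V,A)$, the competition graph $C(D)$ has vertex set $V$, with distinct $x,y$ adjacent iff there is $v\in V$ with arcs $(x,v),(y,v)\in A$. The competition number $k(G)$ of a graph $G$ is the smallest integer $k\ge 0$ such that $G$ together with $k$ new isolated vertices is the competition graph of an acyclic digraph. -}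

module Defs where

open import Level using (0ℓ)
open import Data.Nat using (ℕ; zero; suc; _+_; _≤_; _%_)
open import Data.Fin using (Fin; toℕ; splitAt; _↑ˡ_; _↑ʳ_)
open import Data.Fin.Subset using (Subset; _∈_; _∉_; _⊆_; ∣_∣)
open import Data.Sum using (_⊎_; inj₁; inj₂)
open import Data.Product using (Σ; _×_; ∃; ∃-syntax; _,_)
open import Data.Empty using (⊥)
open import Data.List using (List; length)
open import Data.List.Relation.Unary.All using (All)
open import Data.List.Relation.Unary.Unique.Propositional using (Unique)
import Data.List.Membership.Propositional as LM
open import Relation.Nullary using (¬_)
open import Relation.Binary.PropositionalEquality using (_≡_; _≢_)
open import Relation.Binary.Construct.Closure.ReflexiveTransitive using (Star)
open import Relation.Binary.Construct.Closure.Transitive using (TransClosure)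
open import Function.Definitions using (Injective)
open import Function.Bundles using (_⇔_)

record Graph (n : ℕ) : Set₁ where
  field
    Adj    : Fin n → Fin n → Set
    sym    : ∀ {x y} → Adj x y → Adj y x
    irrefl : ∀ {x} → ¬ Adj x x
open Graph public

module _ {n : ℕ} (G : Graph n) where

  Connected : Set
  Connected = ∀ x y → Star (Adj G) x y

  CycAdj : (m : ℕ) → Fin (suc m) → Fin (suc m) → Set
  CycAdj m i j = (toℕ j ≡ suc (toℕ i) % suc m) ⊎ (toℕ i ≡ suc (toℕ j) % suc m)

  -- A hole (chordless cycle of length ≥ 4), identified with its vertex set S:
  -- S can be listed as c 0, …, c m (m+1 ≥ 4 distinct vertices) so that two
  -- listed vertices are adjacent in G iff they are consecutive cyclically.
  IsHole : Subset n → Set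
  IsHole S = Σ ℕ λ m → Σ (Fin (suc m) → Fin n) λ c →
               (3 ≤ m) × Injective _≡_ _≡_ c
             × (∀ x → (x ∈ S) ⇔ (∃[ i ] c i ≡ x))
             × (∀ i j → Adj G (c i) (c j) ⇔ CycAdj m i j)

  HasExactlyHoles : ℕ → Set
  HasExactlyHoles h = Σ (List (Subset n)) λ hs →
      Unique hs × length hs ≡ h × All IsHole hs
    × (∀ S → IsHole S → S LM.∈ hs)

  -- the edges of a hole S are the edges of G with both ends in S (it is induced)
  HolesPairwiseEdgeDisjoint : Set
  HolesPairwiseEdgeDisjoint = ∀ S T → IsHole S → IsHole T → S ≢ T →
      ∀ x y → x ∈ S → y ∈ S → x ∈ T → y ∈ T → ¬ Adj G x y

  IsClique : Subset n → Set
  IsClique S = ∀ x y → x ∈ S → y ∈ S → x ≢ y → Adj G x y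

  IsMaximalClique : Subset n → Set
  IsMaximalClique S = IsClique S × (∀ T → IsClique T → S ⊆ T → T ⊆ S)

  AtMostOneNonEdgeMaximalClique : Set
  AtMostOneNonEdgeMaximalClique = ∀ S T →
      IsMaximalClique S → 3 ≤ ∣ S ∣ → IsMaximalClique T → 3 ≤ ∣ T ∣ → S ≡ T

  CliqueNumber≡ : ℕ → Set
  CliqueNumber≡ w = (∃[ K ] (IsClique K × ∣ K ∣ ≡ w))
                  × (∀ K → IsClique K → ∣ K ∣ ≤ w)

  -- G ∪ I_k : vertices Fin (n + k); x ↑ˡ k is the copy of vertex x of G,
  -- n ↑ʳ j is the j-th new isolated vertex.
  ExtAdj′ : (k : ℕ) → Fin n ⊎ Fin k → Fin n ⊎ Fin k → Set
  ExtAdj′ k (inj₁ a) (inj₁ b) = Adj G a b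
  ExtAdj′ k _        _        = ⊥

  ExtAdj : (k : ℕ) → Fin (n + k) → Fin (n + k) → Set
  ExtAdj k x y = ExtAdj′ k (splitAt n x) (splitAt n y)

Acyclic : {N : ℕ} → (Fin N → Fin N → Set) → Set
Acyclic Arc = ∀ x → ¬ TransClosure Arc x x

IsCompetitionGraphOf : {N : ℕ} → (Fin N → Fin N → Set) → (Fin N → Fin N → Set) → Set
IsCompetitionGraphOf {N} H Arc =
  ∀ (x y : Fin N) → x ≢ y → (H x y ⇔ (∃[ v ] (Arc x v × Arc y v)))

CompGraphWithIsolated : {n : ℕ} → Graph n → ℕ → Set₁
CompGraphWithIsolated {n} G k = Σ (Fin (n + k) → Fin (n + k) → Set) λ Arc →
  Acyclic Arc × IsCompetitionGraphOf (ExtAdj G k) Arc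

-- k(G) ≤ b  (k(G) is the least such k)
CompetitionNumber≤ : {n : ℕ} → Graph n → ℕ → Set₁
CompetitionNumber≤ G b = Σ ℕ λ k → k ≤ b × CompGraphWithIsolated G k

{-# OPTIONS --safe #-}
module Submission where

open import Defs
open import Data.Nat using (ℕ; zero; suc; _+_; _*_; _∸_; _≤_; _<_; z≤n; s≤s; z<s; _≤?_; _<?_; _%_)
open import Data.Nat.Properties using (≤-refl; ≤-reflexive; ≤-trans; ≤-antisym; <-trans; <-≤-trans; ≤-<-trans; <-irrefl; <-cmp; <⇒≤; <⇒≱; ≮⇒≥; ≰⇒>; m≤m+n; m≤n+m; m≤n⇒m≤1+n; m∸n≤m; ∸-monoʳ-≤; +-mono-≤; +-monoˡ-≤; +-cancelˡ-≤; +-cancelʳ-≤; +-suc; +-comm; +-assoc; +-identityʳ; m+[n∸m]≡n; module ≤-Reasoning) renaming (_≟_ to _≟ⁿ_)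
open import Data.Nat.DivMod using (m<n⇒m%n≡m; n%n≡0)
open import Data.Nat.Induction using (<-rec)
open import Data.Nat.Solver using (module +-*-Solver)
open import Data.Fin using (Fin; _↑ˡ_; _↑ʳ_; zero; suc; _≟_; toℕ; fromℕ; fromℕ<; splitAt)
open import Data.Fin.Properties using (any?; all?; toℕ-injective; toℕ≤pred[n]; toℕ<n; toℕ-fromℕ<; toℕ-fromℕ; splitAt-↑ˡ; splitAt-↑ʳ; splitAt⁻¹-↑ˡ)
open import Data.Fin.Subset using (Subset; _∈_; _∉_; _⊆_; _⊂_; ∣_∣; _∪_; ⁅_⁆; Nonempty)
open import Data.Fin.Subset.Properties using (_∈?_; ∣p∣≤n; p⊂q⇒∣p∣<∣q∣; x∈p∪q⁺; x∈p∪q⁻; x∈⁅x⁆; x∈⁅y⁆⇒x≡y; x∈p⇒∣p-x∣<∣p∣; x∈p∧x≢y⇒x∈p-y; p⊆p∪q; nonempty?; Empty-unique; ∣⊥∣≡0)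
open import Data.Maybe using (Maybe; just; nothing; maybe′)
open import Data.Maybe.Properties using (just-injective; ≡-dec)
open import Data.Vec using (tabulate)
open import Data.Vec.Properties using (lookup∘tabulate; lookup⇒[]=; []=⇒lookup)
open import Data.List using (List; []; _∷_; _++_; length; map; filter; drop; allFin)
open import Data.List.Properties using (filter-reject; length-drop; length-tabulate)
open import Data.List.Relation.Unary.Any as Any using (Any; here; there)
open import Data.List.Relation.Unary.All as All using (All; []; _∷_)
open import Data.List.Relation.Unary.AllPairs using ([]; _∷_)
open import Data.List.Relation.Unary.Unique.Propositional using (Unique)
open import Data.List.Relation.Unary.Unique.Propositional.Properties using (drop⁺; allFin⁺)
open import Data.List.Membership.Propositional using (lose) renaming (_∈_ to _∈ₗ_; _∉_ to _∉ₗ_)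
open import Data.List.Membership.Propositional.Properties using (∈-++⁺ˡ; ∈-++⁺ʳ; ∈-++⁻; ∈-filter⁺; ∈-filter⁻; ∈-map⁺; ∈-map⁻; ∈-allFin)
import Data.List.Membership.DecPropositional as DecMembership
open import Data.List.Relation.Binary.Permutation.Propositional using (_↭_; ↭⇒↭ₛ; ↭-refl; ↭-sym; ↭-trans; prep; swap)
open import Data.List.Relation.Binary.Permutation.Propositional.Properties using (∈-resp-↭; All-resp-↭; ↭-length; map⁺)
import Data.List.Relation.Binary.Permutation.Setoid.Properties as SetoidPermutation
open import Data.Product using (Σ; _×_; _,_; proj₁; proj₂; ∃-syntax)
import Data.Product.Properties as ×
open import Data.Sum as Sum using (_⊎_; inj₁; inj₂; [_,_]′)
open import Data.Empty using (⊥; ⊥-elim)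
open import Function using (_∘_; id; case_of_; _⇔_; mk⇔; Equivalence)
open import Function.Definitions using (Injective)
open import Relation.Nullary using (¬_; Dec; yes; no; does; contradiction; ¬?)
open import Relation.Nullary.Decidable using (_⊎-dec_; _×-dec_; _→-dec_; map′; dec-true)
open import Relation.Unary using (Decidable)
open import Relation.Binary.Definitions using (tri<; tri≈; tri>)
open import Relation.Binary.Construct.Closure.ReflexiveTransitive as Star using (Star; ε; _◅_; _◅◅_)
open import Relation.Binary.Construct.Closure.Transitive using (TransClosure; [_]; _∷_)
open import Relation.Binary.PropositionalEquality as ≡ using (_≡_; _≢_; refl; cong; subst)

-- All cliques with at least three vertices lie in K, so besides K only single edges have to be
-- covered. There are at most n − 1 edges outside K: n − |K| of them connect K to the other
-- vertices, and whenever an edge xy of G is not yet covered, choosing it with x and y closest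
-- in the covered part makes it the only uncovered edge of an induced cycle; that cycle is a
-- hole (triangles lie in K), so at most h = |K| − 1 further edges occur. In the digraph, K
-- preys on i₂, and the other edges receive distinct preys greedily: a multigraph on |R| ≥ 2
-- vertices with at most |R| + p − 2 edges, p ≥ 1, has a vertex v of degree at most p, so with
-- p preys available the edges at v can be served and v joins the available preys. Initially
-- i₁ is the only available prey.

private variable
  A : Set
  n : ℕ

-- Lists: filtering, membership and length.

length-filter-¬ : {P : A → Set} (P? : Decidable P) (xs : List A) →
  length (filter P? xs) + length (filter (¬? ∘ P?) xs) ≡ length xs
length-filter-¬ P? [] = refl
length-filter-¬ P? (x ∷ xs) with P? x
... | yes _ = cong suc (length-filter-¬ P? xs)
... | no  _ = ≡.trans (+-suc _ _) (cong suc (length-filter-¬ P? xs))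

Any⇒↭ : {P : A → Set} {xs : List A} → Any P xs → ∃[ x ] ∃[ ys ] (xs ↭ x ∷ ys × P x)
Any⇒↭ (here px) = _ , _ , ↭-refl , px
Any⇒↭ (there {x} p) with y , ys , σ , py ← Any⇒↭ p =
  y , x ∷ ys , ↭-trans (prep x σ) (swap x y ↭-refl) , py

∈-∷⁻ : {x y : A} {ys : List A} → x ∈ₗ y ∷ ys → x ≢ y → x ∈ₗ ys
∈-∷⁻ (here x≡y) x≢y = contradiction x≡y x≢y
∈-∷⁻ (there m) _ = m

∈-drop⁻ : (k : ℕ) {x : A} {xs : List A} → x ∈ₗ drop k xs → x ∈ₗ xs
∈-drop⁻ zero m = m
∈-drop⁻ (suc k) {xs = _ ∷ _} m = there (∈-drop⁻ k m)

2≤length : {x y : A} {xs : List A} → x ∈ₗ xs → y ∈ₗ xs → x ≢ y → 2 ≤ length xs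
2≤length {xs = _ ∷ []} (here refl) (here refl) x≢y = contradiction refl x≢y
2≤length {xs = _ ∷ _ ∷ _} _ _ _ = s≤s (s≤s z≤n)

-- Degrees in multigraphs given by edge lists.

Edge : ℕ → Set
Edge n = Fin n × Fin n

Incident : Fin n → Edge n → Set
Incident x (u , w) = x ≡ u ⊎ x ≡ w

incident? : (x : Fin n) → Decidable (Incident x)
incident? x (u , w) = (x ≟ u) ⊎-dec (x ≟ w)

Within : List (Fin n) → List (Edge n) → Set
Within R L = ∀ {e} → e ∈ₗ L → ∀ {x} → Incident x e → x ∈ₗ R

Loopless : List (Edge n) → Set
Loopless L = ∀ {e} → e ∈ₗ L → proj₁ e ≢ proj₂ e

degree : List (Edge n) → Fin n → ℕ
degree L x = length (filter (incident? x) L)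

endpoints : List (Edge n) → List (Fin n)
endpoints [] = []
endpoints ((u , w) ∷ L) = u ∷ w ∷ endpoints L

occurrences : Fin n → List (Fin n) → ℕ
occurrences x xs = length (filter (x ≟_) xs)

length-endpoints : (L : List (Edge n)) → length (endpoints L) ≡ length L + length L
length-endpoints [] = refl
length-endpoints (_ ∷ L) =
  cong suc (≡.trans (cong suc (length-endpoints L)) (≡.sym (+-suc _ _)))

-- Equality can fail: a loop counts once in the degree but puts its vertex twice among the
-- endpoints.
degree≤occurrences : (L : List (Edge n)) (x : Fin n) → degree L x ≤ occurrences x (endpoints L)
degree≤occurrences [] x = z≤n
degree≤occurrences ((u , w) ∷ L) x with x ≟ u
degree≤occurrences ((u , w) ∷ L) x | yes _ with x ≟ w
... | yes _ = s≤s (m≤n⇒m≤1+n (degree≤occurrences L x))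
... | no  _ = s≤s (degree≤occurrences L x)
degree≤occurrences ((u , w) ∷ L) x | no _ with x ≟ w
... | yes _ = s≤s (degree≤occurrences L x)
... | no  _ = degree≤occurrences L x

occurrences-remove : {x y : Fin n} → x ≢ y → (zs : List (Fin n)) →
  occurrences x (filter (¬? ∘ (y ≟_)) zs) ≡ occurrences x zs
occurrences-remove x≢y [] = refl
occurrences-remove {x = x} {y} x≢y (z ∷ zs) with y ≟ z
... | yes refl = ≡.trans (occurrences-remove x≢y zs) (cong length (≡.sym (filter-reject (x ≟_) x≢y)))
... | no _ with x ≟ z
...   | yes _ = cong suc (occurrences-remove x≢y zs)
...   | no  _ = occurrences-remove x≢y zs

-- Distinct members of `R` occupy disjoint sets of positions in `zs`: deleting all occurrences of
-- the head leaves the counts of the other members unchanged, so induction applies to what remains.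
occurrences-bound : {d : ℕ} {R : List (Fin n)} → Unique R → (zs : List (Fin n)) →
  (∀ {x} → x ∈ₗ R → d ≤ occurrences x zs) → length R * d ≤ length zs
occurrences-bound {R = []} _ zs _ = z≤n
occurrences-bound {R = x ∷ R} (x∉R ∷ uR) zs d≤ =
  ≤-trans (+-mono-≤ (d≤ (here refl)) (occurrences-bound uR (filter (¬? ∘ (x ≟_)) zs) d≤′))
          (≤-reflexive (length-filter-¬ (x ≟_) zs))
  where
  d≤′ : ∀ {y} → y ∈ₗ R → _ ≤ occurrences y (filter (¬? ∘ (x ≟_)) zs)
  d≤′ y∈R = ≤-trans (d≤ (there y∈R))
    (≤-reflexive (≡.sym (occurrences-remove (λ y≡x → All.lookup x∉R y∈R (≡.sym y≡x)) zs)))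

handshake : {d : ℕ} {R : List (Fin n)} {L : List (Edge n)} → Unique R →
  (∀ {x} → x ∈ₗ R → d ≤ degree L x) → length R * d ≤ length L + length L
handshake {L = L} uR d≤ = ≤-trans
  (occurrences-bound uR (endpoints L) (λ {x} m → ≤-trans (d≤ m) (degree≤occurrences L x)))
  (≤-reflexive (length-endpoints L))

-- With r = 2 + a and p = 1 + b, the last two hypotheses bound 2l + 4 from above by 6 + 2a + 2b and
-- from below by 8 + 2a + 2b + ab.
sparse-arith : ∀ r p l → 2 ≤ r → 1 ≤ p → l + 2 ≤ r + p → r * suc p ≤ l + l → ⊥
sparse-arith (suc (suc a)) (suc b) l (s≤s (s≤s z≤n)) (s≤s z≤n) sparse dense =
  <-irrefl refl (begin-strict
    (l + 2) + (l + 2)               ≤⟨ +-mono-≤ sparse sparse ⟩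
    (2 + a + (1 + b)) + (2 + a + (1 + b)) <⟨ m≤m+n _ (1 + a * b) ⟩
    suc ((2 + a + (1 + b)) + (2 + a + (1 + b))) + (1 + a * b)
      ≡⟨ solve 2 (λ x y → (con 1 :+ ((con 2 :+ x :+ (con 1 :+ y)) :+ (con 2 :+ x :+ (con 1 :+ y)))) :+ (con 1 :+ x :* y)
           := (con 2 :+ x) :* (con 2 :+ y) :+ con 4) refl a b ⟩
    (2 + a) * (2 + b) + 4           ≤⟨ +-monoˡ-≤ 4 dense ⟩
    (l + l) + 4                     ≡⟨ solve 1 (λ x → (x :+ x) :+ con 4 := (x :+ con 2) :+ (x :+ con 2)) refl l ⟩
    (l + 2) + (l + 2)               ∎)
  where
  open ≤-Reasoning
  open +-*-Solver

-- Otherwise every vertex of `R` has degree at least p + 1, and the degree sum is too large for so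
-- few edges.
low-degree-vertex : {p : ℕ} {R : List (Fin n)} {L : List (Edge n)} → Unique R →
  2 ≤ length R → 1 ≤ p → length L + 2 ≤ length R + p →
  Any (λ x → degree L x ≤ p) R
low-degree-vertex {p = p} {R} {L} uR 2≤R 1≤p sparse with Any.any? (λ x → degree L x ≤? p) R
... | yes a = a
... | no ¬a = ⊥-elim (sparse-arith (length R) p (length L) 2≤R 1≤p sparse
  (handshake {L = L} uR (λ {x} m → ≰⇒> (λ le → ¬a (lose m le)))))

-- Greedy assignment of preys to edges.

-- A prey is a vertex, or nothing for the extra isolated vertex i₁.
Prey : ℕ → Set
Prey n = Maybe (Fin n)

preyRank : (Fin n → ℕ) → Prey n → ℕ
preyRank rank = maybe′ rank 0

-- Because `owner` is a function on preys, different edges automatically have different preys. The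
-- rank will certify acyclicity; its vanishing outside `R` keeps preys that are not in `R` below all
-- vertices of `R`.
record PreyAssignment (R : List (Fin n)) (L : List (Edge n)) (P : List (Prey n)) : Set where
  field
    owner       : Prey n → Maybe (Edge n)
    rank        : Fin n → ℕ
    rank-pos    : ∀ {x} → x ∈ₗ R → 0 < rank x
    rank-zero   : ∀ {x} → x ∉ₗ R → rank x ≡ 0
    owner-∈     : ∀ {p e} → owner p ≡ just e → e ∈ₗ L
    owned       : ∀ {p e} → owner p ≡ just e → p ∈ₗ P ⊎ p ∈ₗ map just R
    decreasing  : ∀ {p e} → owner p ≡ just e → ∀ {x} → Incident x e → preyRank rank p < rank x
    total       : ∀ {e} → e ∈ₗ L → ∃[ p ] owner p ≡ just e

module _ {n : ℕ} where
  open DecMembership (_≟_ {n}) using () renaming (_∈?_ to _∈ₗ?_)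

  private variable
    R R′ : List (Fin n)
    L L′ : List (Edge n)
    P : List (Prey n)

  assign-[] : PreyAssignment R [] P
  assign-[] {R} = record
    { owner = λ _ → nothing ; rank = ρ ; rank-pos = pos ; rank-zero = zer
    ; owner-∈ = λ () ; owned = λ () ; decreasing = λ () ; total = λ () }
    where
    ρ : Fin n → ℕ
    ρ x with x ∈ₗ? R
    ... | yes _ = 1
    ... | no  _ = 0
    pos : ∀ {x} → x ∈ₗ R → 0 < ρ x
    pos {x} m with x ∈ₗ? R
    ... | yes _ = z<s
    ... | no ¬m = contradiction m ¬m
    zer : ∀ {x} → x ∉ₗ R → ρ x ≡ 0
    zer {x} ¬m with x ∈ₗ? R
    ... | yes m = contradiction m ¬m
    ... | no  _ = refl

  -- The prey `p` lies outside `R` and so has rank zero, while both ends of `e` have positive rank;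
  -- the ranks can therefore stay. No old edge loses its prey, since every prey owned before lies in
  -- `P` or in `R`.
  assign-∷ : ∀ {e p} → (∀ {x} → Incident x e → x ∈ₗ R) → p ∉ₗ P → p ∉ₗ map just R →
    PreyAssignment R L P → PreyAssignment R (e ∷ L) (p ∷ P)
  assign-∷ {R} {P} {L} {e} {p} e⊆R p∉P p∉R a = record
    { owner = own ; rank = rank ; rank-pos = rank-pos ; rank-zero = rank-zero
    ; owner-∈ = λ {q} → own-∈ {q} ; owned = λ {q} → own-d {q}
    ; decreasing = λ {q} → dec {q} ; total = tot }
    where
    open PreyAssignment a
    own : Prey n → Maybe (Edge n)
    own q with ≡-dec _≟_ q p
    ... | yes _ = just e
    ... | no  _ = owner q
    own-∈ : ∀ {q f} → own q ≡ just f → f ∈ₗ e ∷ L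
    own-∈ {q} eq with ≡-dec _≟_ q p
    ... | yes _ = here (≡.sym (just-injective eq))
    ... | no  _ = there (owner-∈ eq)
    own-d : ∀ {q f} → own q ≡ just f → q ∈ₗ p ∷ P ⊎ q ∈ₗ map just R
    own-d {q} eq with ≡-dec _≟_ q p
    ... | yes q≡p = inj₁ (here q≡p)
    ... | no  _ = [ inj₁ ∘ there , inj₂ ]′ (owned eq)
    p-rank : ∀ q → q ≡ p → preyRank rank q ≡ 0
    p-rank nothing _ = refl
    p-rank (just x) refl = rank-zero (λ m → p∉R (∈-map⁺ just m))
    dec : ∀ {q f} → own q ≡ just f → ∀ {x} → Incident x f → preyRank rank q < rank x
    dec {q} eq i with ≡-dec _≟_ q p
    dec {q} refl i | yes q≡p = ≤-<-trans (≤-reflexive (p-rank q q≡p)) (rank-pos (e⊆R i))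
    dec eq i | no _ = decreasing eq i
    own-new : own p ≡ just e
    own-new with ≡-dec _≟_ p p
    ... | yes _ = refl
    ... | no ¬r = contradiction refl ¬r
    own-old : ∀ {q f} → owner q ≡ just f → own q ≡ just f
    own-old {q} eq with ≡-dec _≟_ q p
    ... | yes refl = ⊥-elim ([ p∉P , p∉R ]′ (owned eq))
    ... | no  _ = eq
    tot : ∀ {f} → f ∈ₗ e ∷ L → ∃[ q ] own q ≡ just f
    tot (here refl) = p , own-new
    tot (there m) with q , eq ← total m = q , own-old eq

  assign-++ : ∀ F → Within R F → length F ≤ length P → Unique P →
    (∀ {p} → p ∈ₗ P → p ∉ₗ map just R) →
    PreyAssignment R L (drop (length F) P) → PreyAssignment R (F ++ L) P
  assign-++ [] F⊆R le uP P∩R a = a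
  assign-++ {P = p ∷ P} (e ∷ F) F⊆R (s≤s le) (p∉P ∷ uP) P∩R a =
    assign-∷ (F⊆R (here refl)) (λ m → All.lookup p∉P m refl) (P∩R (here refl))
      (assign-++ F (F⊆R ∘ there) le uP (P∩R ∘ there) a)

  -- Raising the rank of all of R by one leaves room for v just below it.
  assign-retire : ∀ {v} → Within R L →
    PreyAssignment R L (just v ∷ P) → PreyAssignment (v ∷ R) L P
  assign-retire {R} {L} {P} {v} L⊆R a = record
    { owner = owner ; rank = ρ ; rank-pos = pos ; rank-zero = zer
    ; owner-∈ = owner-∈ ; owned = own-d ; decreasing = dec ; total = total }
    where
    open PreyAssignment a
    ρ : Fin n → ℕ
    ρ x with x ∈ₗ? (v ∷ R)
    ... | yes _ = suc (rank x)
    ... | no  _ = 0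
    ρ-∈ : ∀ {x} → x ∈ₗ v ∷ R → ρ x ≡ suc (rank x)
    ρ-∈ {x} m with x ∈ₗ? (v ∷ R)
    ... | yes _ = refl
    ... | no ¬m = contradiction m ¬m
    ρ-≤ : ∀ p → preyRank ρ p ≤ suc (preyRank rank p)
    ρ-≤ nothing = z≤n
    ρ-≤ (just x) with x ∈ₗ? (v ∷ R)
    ... | yes _ = ≤-refl
    ... | no  _ = z≤n
    pos : ∀ {x} → x ∈ₗ v ∷ R → 0 < ρ x
    pos m = ≤-trans z<s (≤-reflexive (≡.sym (ρ-∈ m)))
    zer : ∀ {x} → x ∉ₗ v ∷ R → ρ x ≡ 0
    zer {x} ¬m with x ∈ₗ? (v ∷ R)
    ... | yes m = contradiction m ¬m
    ... | no  _ = refl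
    own-d : ∀ {p e} → owner p ≡ just e → p ∈ₗ P ⊎ p ∈ₗ map just (v ∷ R)
    own-d eq with owned eq
    ... | inj₁ (here q) = inj₂ (here q)
    ... | inj₁ (there m) = inj₁ m
    ... | inj₂ m = inj₂ (there m)
    dec : ∀ {p e} → owner p ≡ just e → ∀ {x} → Incident x e → preyRank ρ p < ρ x
    dec {p} eq i = ≤-<-trans (ρ-≤ p)
      (<-≤-trans (s≤s (decreasing eq i)) (≤-reflexive (≡.sym (ρ-∈ (there (L⊆R (owner-∈ eq) i))))))

  assign-resp : R ↭ R′ → (∀ {e} → e ∈ₗ L → e ∈ₗ L′) → (∀ {e} → e ∈ₗ L′ → e ∈ₗ L) →
    PreyAssignment R L P → PreyAssignment R′ L′ P
  assign-resp σ L⊆L′ L′⊆L a = record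
    { owner = owner ; rank = rank
    ; rank-pos = rank-pos ∘ ∈-resp-↭ (↭-sym σ)
    ; rank-zero = λ ¬m → rank-zero (¬m ∘ ∈-resp-↭ σ)
    ; owner-∈ = L⊆L′ ∘ owner-∈
    ; owned = λ eq → [ inj₁ , inj₂ ∘ ∈-resp-↭ (map⁺ just σ) ]′ (owned eq)
    ; decreasing = decreasing ; total = total ∘ L′⊆L }
    where open PreyAssignment a

  -- A vertex `v` of degree at most the number of preys is removed with its edges and then serves as
  -- a further prey for the other edges. The smaller vertex list arises from a permutation, so `r`
  -- bounds its length to make the recursion structural.
  assign-preys : ∀ r (R : List (Fin n)) (L : List (Edge n)) (P : List (Prey n)) →
    length R ≤ r → Unique R → Unique P → (∀ {p} → p ∈ₗ P → p ∉ₗ map just R) →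
    Within R L → Loopless L → 1 ≤ length P → length L + 2 ≤ length R + length P →
    PreyAssignment R L P
  assign-preys r R [] P R≤r uR uP P∩R L⊆R loopless 1≤P sparse = assign-[]
  assign-preys r R L@(e ∷ _) P R≤r uR uP P∩R L⊆R loopless 1≤P sparse
    -- Looplessness yields two different vertices in `R` as soon as one edge is left.
    with 2≤R ← 2≤length (L⊆R (here refl) (inj₁ refl)) (L⊆R (here refl) (inj₂ refl)) (loopless (here refl))
    with v , R′ , σ , d≤P ← Any⇒↭ (low-degree-vertex {L = L} uR 2≤R 1≤P sparse)
    with r | ≤-trans (≤-reflexive (≡.sym (↭-length σ))) R≤r
       | SetoidPermutation.Unique-resp-↭ (≡.setoid _) (↭⇒↭ₛ σ) uR
  ... | suc r′ | s≤s R′≤r′ | v∉R′ ∷ uR′ =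
    -- From the inside out: the edges avoiding `v` are served with `v` available, then `v` joins the
    -- ranked vertices, and finally the edges at `v` take the first `d` preys of `P`.
    assign-resp (↭-sym σ) from to
      (assign-++ F (λ m i → ∈-resp-↭ σ (L⊆R (proj₁ (∈-filter⁻ (incident? v) {xs = L} m)) i)) d≤P uP
        (λ m m′ → P∩R m (∈-resp-↭ (map⁺ just (↭-sym σ)) m′))
        (assign-retire L′⊆R′
          (assign-preys r′ R′ L₁ (just v ∷ drop d P) R′≤r′ uR′
            (All.tabulate (λ { m refl → P∩R (∈-drop⁻ d m) (∈-map⁺ just (∈-resp-↭ (↭-sym σ) (here refl))) })
              ∷ drop⁺ d uP)
            -- The pool contains `v`, so it is nonempty even if the edges at `v` use up all of `P`.
            P′∩R′ L′⊆R′ (λ m → loopless (L₁⊆L m)) (s≤s z≤n) sparse′)))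
    where
    F L₁ : List (Edge n)
    F = filter (incident? v) L
    L₁ = filter (¬? ∘ incident? v) L
    d : ℕ
    d = length F
    L₁⊆L : ∀ {e} → e ∈ₗ L₁ → e ∈ₗ L
    L₁⊆L m = proj₁ (∈-filter⁻ (¬? ∘ incident? v) {xs = L} m)
    L′⊆R′ : Within R′ L₁
    L′⊆R′ m i = ∈-∷⁻ (∈-resp-↭ σ (L⊆R (L₁⊆L m) i))
      (λ { refl → proj₂ (∈-filter⁻ (¬? ∘ incident? v) {xs = L} m) i })
    P′∩R′ : ∀ {p} → p ∈ₗ just v ∷ drop d P → p ∉ₗ map just R′
    P′∩R′ (here refl) m with _ , m′ , refl ← ∈-map⁻ just m = All.lookup v∉R′ m′ refl
    P′∩R′ (there m) m′ = P∩R (∈-drop⁻ d m) (∈-resp-↭ (map⁺ just (↭-sym σ)) (there m′))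
    from : ∀ {e} → e ∈ₗ F ++ L₁ → e ∈ₗ L
    from m with ∈-++⁻ F m
    ... | inj₁ m′ = proj₁ (∈-filter⁻ (incident? v) {xs = L} m′)
    ... | inj₂ m′ = L₁⊆L m′
    to : ∀ {e} → e ∈ₗ L → e ∈ₗ F ++ L₁
    to {e} m with incident? v e
    ... | yes i = ∈-++⁺ˡ (∈-filter⁺ (incident? v) m i)
    ... | no ¬i = ∈-++⁺ʳ F (∈-filter⁺ (¬? ∘ incident? v) m ¬i)
    -- Edges and preys both drop by `d`, and `v` moves from the vertices to the preys, so the bound
    -- persists.
    sparse′ : length L₁ + 2 ≤ length R′ + suc (length (drop d P))
    sparse′ = +-cancelˡ-≤ d _ _ (begin
      d + (length L₁ + 2)  ≡⟨ ≡.sym (+-assoc d _ 2) ⟩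
      d + length L₁ + 2    ≡⟨ cong (_+ 2) (length-filter-¬ (incident? v) L) ⟩
      length L + 2         ≤⟨ sparse ⟩
      length R + length P  ≡⟨ ≡.cong₂ _+_ (↭-length σ) (≡.sym P-split) ⟩
      suc (length R′) + (d + length (drop d P))
        ≡⟨ solve 3 (λ a b c → con 1 :+ a :+ (b :+ c) := b :+ (a :+ (con 1 :+ c))) refl (length R′) d (length (drop d P)) ⟩
      d + (length R′ + suc (length (drop d P))) ∎)
      where
      open ≤-Reasoning
      open +-*-Solver
      P-split : d + length (drop d P) ≡ length P
      P-split = ≡.trans (cong (d +_) (length-drop d P)) (m+[n∸m]≡n d≤P)

-- Finite search and subsets.

-- Decidability is demanded only at the members of the list: for subsets it will come from the proof
-- that each of them is a hole.
search : {Q : A → Set} {xs : List A} → All (λ x → Dec (Q x)) xs → Dec (Any Q xs)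
search [] = no λ ()
search (d ∷ ds) = map′ Any.fromSum Any.toSum (d ⊎-dec search ds)

image : ∀ {m} → (Fin m → Fin n) → Subset n
image c = tabulate (λ x → does (any? (λ i → c i ≟ x)))

∈-image : ∀ {m} (c : Fin m → Fin n) (x : Fin n) → x ∈ image c ⇔ (∃[ i ] c i ≡ x)
∈-image {n} c x = mk⇔ to from
  where
  look = lookup∘tabulate (λ y → does (any? (λ i → c i ≟ y))) x
  to : x ∈ image c → ∃[ i ] c i ≡ x
  to m with any? (λ i → c i ≟ x) | ≡.trans (≡.sym look) ([]=⇒lookup m)
  ... | yes w | _ = w
  from : (∃[ i ] c i ≡ x) → x ∈ image c
  from w = lookup⇒[]= x (image c) (≡.trans look (dec-true (any? (λ i → c i ≟ x)) w))

3≤∣∣ : {T : Subset n} {x y z : Fin n} → x ∈ T → y ∈ T → z ∈ T → y ≢ x → z ≢ x → z ≢ y → 3 ≤ ∣ T ∣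
3≤∣∣ x∈ y∈ z∈ y≢x z≢x z≢y =
  ≤-trans (s≤s (≤-trans (s≤s (≤-trans (s≤s z≤n) (x∈p⇒∣p-x∣<∣p∣ z∈″))) (x∈p⇒∣p-x∣<∣p∣ y∈′)))
          (x∈p⇒∣p-x∣<∣p∣ x∈)
  where
  y∈′ = x∈p∧x≢y⇒x∈p-y y∈ y≢x
  z∈″ = x∈p∧x≢y⇒x∈p-y (x∈p∧x≢y⇒x∈p-y z∈ z≢x) z≢y

-- Paths and geodesics.

module _ {n : ℕ} {E : Fin n → Fin n → Set} where

  data Path : ℕ → Fin n → Fin n → Set where
    []  : ∀ {x} → Path 0 x x
    _∷_ : ∀ {k x y z} → E x y → Path k y z → Path (suc k) x z

  infixr 5 _++ᵖ_
  _++ᵖ_ : ∀ {k l x y z} → Path k x y → Path l y z → Path (k + l) x z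
  []      ++ᵖ q = q
  (e ∷ p) ++ᵖ q = e ∷ (p ++ᵖ q)

  Star⇒Path : ∀ {x y} → Star E x y → ∃[ k ] Path k x y
  Star⇒Path ε = 0 , []
  Star⇒Path (e ◅ s) with k , p ← Star⇒Path s = suc k , e ∷ p

  path? : (∀ x y → Dec (E x y)) → ∀ k x y → Dec (Path k x y)
  path? E? zero x y = map′ (λ { refl → [] }) (λ { [] → refl }) (x ≟ y)
  path? E? (suc k) x y = map′ (λ (_ , e , p) → e ∷ p) (λ { (e ∷ p) → _ , e , p })
    (any? λ z → E? x z ×-dec path? E? k z y)

  -- Positions beyond the length give the end vertex, so that plain natural numbers can serve as
  -- indices.
  at : ∀ {k x y} → Path k x y → ℕ → Fin n
  at {x = x} p zero = x
  at {x = x} [] (suc i) = x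
  at (e ∷ p) (suc i) = at p i

  at-end : ∀ {k x y} (p : Path k x y) → at p k ≡ y
  at-end [] = refl
  at-end (e ∷ p) = at-end p

  at-step : ∀ {k x y} (p : Path k x y) {i} → i < k → E (at p i) (at p (suc i))
  at-step (e ∷ [])      {zero} _ = e
  at-step (e ∷ (_ ∷ _)) {zero} _ = e
  at-step (e ∷ p) {suc i} (s≤s i<k) = at-step p i<k

  prefix : ∀ {k x y} (p : Path k x y) {j} → j ≤ k → Path j x (at p j)
  prefix p {zero} _ = []
  prefix (e ∷ p) {suc j} (s≤s j≤k) = e ∷ prefix p j≤k

  segment : ∀ {k x y} (p : Path k x y) {i j} → i ≤ j → j ≤ k → Path (j ∸ i) (at p i) (at p j)
  segment p {zero} _ j≤k = prefix p j≤k
  segment (e ∷ p) {suc i} {suc j} (s≤s i≤j) (s≤s j≤k) = segment p i≤j j≤k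

  suffix : ∀ {k x y} (p : Path k x y) {i} → i ≤ k → Path (k ∸ i) (at p i) y
  suffix {k} p i≤k = subst (Path _ _) (at-end p) (segment p i≤k ≤-refl)

  Geodesic : ℕ → Fin n → Fin n → Set
  Geodesic k x y = ∀ {j} → j < k → ¬ Path j x y

  -- Replacing the stretch from `i` to `j` by `q` gives a path of length i + l + (k - j), which
  -- minimality bounds below by k. It is used with l = 0 to exclude repeated vertices and with l = 1
  -- to exclude chords.
  geodesic-segment : ∀ {k x y} (p : Path k x y) → Geodesic k x y →
    ∀ {i j l} → i ≤ j → j ≤ k → Path l (at p i) (at p j) → j ≤ i + l
  geodesic-segment {k} p geo {i} {j} {l} i≤j j≤k q = +-cancelʳ-≤ (k ∸ j) j (i + l) (begin
    j + (k ∸ j)       ≡⟨ m+[n∸m]≡n j≤k ⟩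
    k                 ≤⟨ ≮⇒≥ (λ lt → geo lt (prefix p (≤-trans i≤j j≤k) ++ᵖ q ++ᵖ suffix p j≤k)) ⟩
    i + (l + (k ∸ j)) ≡⟨ ≡.sym (+-assoc i l _) ⟩
    i + l + (k ∸ j)   ∎)
    where open ≤-Reasoning

-- Successors around a cycle.

module _ {m : ℕ} where

  next⁻ : ∀ {i j : Fin (suc m)} → toℕ j ≡ suc (toℕ i) % suc m →
    toℕ j ≡ suc (toℕ i) ⊎ (toℕ i ≡ m × toℕ j ≡ 0)
  next⁻ {i} {j} eq with toℕ i <? m
  ... | yes i<m = inj₁ (≡.trans eq (m<n⇒m%n≡m (s≤s i<m)))
  ... | no  i≮m = inj₂ (i≡m , ≡.trans eq (≡.trans (cong (λ k → suc k % suc m) i≡m) (n%n≡0 (suc m))))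
    where
    i≡m : toℕ i ≡ m
    i≡m = ≤-antisym (toℕ≤pred[n] i) (≮⇒≥ i≮m)

  next⁺ : ∀ {i j : Fin (suc m)} → toℕ j ≡ suc (toℕ i) ⊎ (toℕ i ≡ m × toℕ j ≡ 0) →
    toℕ j ≡ suc (toℕ i) % suc m
  next⁺ {i} {j} (inj₁ eq) = ≡.trans eq (≡.sym (m<n⇒m%n≡m (subst (_< suc m) eq (toℕ<n j))))
  next⁺ {i} {j} (inj₂ (i≡m , j≡0)) =
    ≡.trans j≡0 (≡.sym (≡.trans (cong (λ k → suc k % suc m) i≡m) (n%n≡0 (suc m))))

-- Edges covered by the clique and a list.

module _ {n : ℕ} (G : Graph n) (K : Subset n) where
  open DecMembership (×.≡-dec (_≟_ {n}) (_≟_ {n})) using () renaming (_∈?_ to _∈ₗ?_)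

  -- A decidable stand-in for adjacency, which need not be decidable; the aim is a short `L` for
  -- which the two coincide.
  Covered : List (Edge n) → Fin n → Fin n → Set
  Covered L x y = (x ∈ K × y ∈ K × x ≢ y) ⊎ ((x , y) ∈ₗ L ⊎ (y , x) ∈ₗ L)

  covered? : ∀ L x y → Dec (Covered L x y)
  covered? L x y = (x ∈? K ×-dec y ∈? K ×-dec ¬? (x ≟ y)) ⊎-dec ((x , y) ∈ₗ? L ⊎-dec (y , x) ∈ₗ? L)

  covered-sym : ∀ {L x y} → Covered L x y → Covered L y x
  covered-sym (inj₁ (x∈K , y∈K , x≢y)) = inj₁ (y∈K , x∈K , x≢y ∘ ≡.sym)
  covered-sym (inj₂ m) = inj₂ (Sum.swap m)

  covered-mono : ∀ {L L′} → (∀ {e} → e ∈ₗ L → e ∈ₗ L′) → ∀ {x y} → Covered L x y → Covered L′ x y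
  covered-mono L⊆L′ = Sum.map₂ (Sum.map L⊆L′ L⊆L′)

  K-connected : ∀ {L x y} → x ∈ K → y ∈ K → Star (Covered L) x y
  K-connected {x = x} {y} x∈K y∈K with x ≟ y
  ... | yes refl = ε
  ... | no  x≢y = inj₁ (x∈K , y∈K , x≢y) ◅ ε

  Edges : List (Edge n) → Set
  Edges = All (λ (x , y) → Adj G x y)

  covered⇒adj : IsClique G K → ∀ {L} → Edges L → ∀ {x y} → Covered L x y → Adj G x y
  covered⇒adj clq es (inj₁ (x∈K , y∈K , x≢y)) = clq _ _ x∈K y∈K x≢y
  covered⇒adj clq es (inj₂ (inj₁ m)) = All.lookup es m
  covered⇒adj clq es (inj₂ (inj₂ m)) = sym G (All.lookup es m)

  -- Cliques with at least three vertices.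

  module _ (clique-K : IsClique G K) (max-K : ∀ T → IsClique G T → ∣ T ∣ ≤ ∣ K ∣)
           (unique-max : AtMostOneNonEdgeMaximalClique G) where

    maximal-K : IsMaximalClique G K
    maximal-K = clique-K , λ T clique-T K⊆T → inK T clique-T K⊆T
      where
      inK : ∀ T → IsClique G T → K ⊆ T → T ⊆ K
      inK T clique-T K⊆T {x} x∈T with x ∈? K
      ... | yes x∈K = x∈K
      ... | no  x∉K = contradiction (max-K T clique-T) (<⇒≱ (p⊂q⇒∣p∣<∣q∣ (K⊆T , x , x∈T , x∉K)))

    -- A clique T ⊈ K would extend to a maximal clique other than K.
    clique⊆K : ∀ d T → n ≤ ∣ T ∣ + d → IsClique G T → 3 ≤ ∣ T ∣ → T ⊆ K
    clique⊆K d T n≤ clique-T 3≤T {x} x∈T with x ∈? K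
    ... | yes x∈K = x∈K
    ... | no  x∉K = subst (x ∈_) (unique-max T K (clique-T , maximal-T) 3≤T
                      maximal-K (≤-trans 3≤T (max-K T clique-T))) x∈T
      where
      -- By induction a clique properly containing `T` lies in `K`, yet it contains `x`. Hence `T`
      -- is itself maximal, and no search for an extension is needed. The number `d` bounds the
      -- vertices outside `T`; at zero there is no proper superset.
      larger : ∀ d → n ≤ ∣ T ∣ + d → ∀ T′ → IsClique G T′ → T ⊂ T′ → ⊥
      larger zero n≤ T′ _ T⊂T′ = <-irrefl refl
        (<-≤-trans (p⊂q⇒∣p∣<∣q∣ T⊂T′) (≤-trans (∣p∣≤n T′) (≤-trans n≤ (≤-reflexive (+-identityʳ _)))))
      larger (suc d) n≤ T′ clique-T′ T⊂T′ = x∉K (clique⊆K d T′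
        (≤-trans n≤ (≤-trans (≤-reflexive (+-suc _ d)) (+-monoˡ-≤ d (p⊂q⇒∣p∣<∣q∣ T⊂T′))))
        clique-T′ (≤-trans 3≤T (<⇒≤ (p⊂q⇒∣p∣<∣q∣ T⊂T′))) (proj₁ T⊂T′ x∈T))
      maximal-T : ∀ T′ → IsClique G T′ → T ⊆ T′ → T′ ⊆ T
      maximal-T T′ clique-T′ T⊆T′ {y} y∈T′ with y ∈? T
      ... | yes y∈T = y∈T
      ... | no  y∉T = ⊥-elim (larger d n≤ T′ clique-T′ (T⊆T′ , y , y∈T′ , y∉T))

    triangle⊆K : ∀ {x y z} → Adj G x y → Adj G y z → Adj G x z → x ∈ K × z ∈ K
    triangle⊆K {x} {y} {z} xy yz xz = T⊆K x∈T , T⊆K z∈T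
      where
      T : Subset n
      T = ⁅ x ⁆ ∪ (⁅ y ⁆ ∪ ⁅ z ⁆)
      x∈T : x ∈ T
      x∈T = x∈p∪q⁺ (inj₁ (x∈⁅x⁆ x))
      y∈T : y ∈ T
      y∈T = x∈p∪q⁺ (inj₂ (x∈p∪q⁺ (inj₁ (x∈⁅x⁆ y))))
      z∈T : z ∈ T
      z∈T = x∈p∪q⁺ {p = ⁅ x ⁆} (inj₂ (x∈p∪q⁺ {p = ⁅ y ⁆} (inj₂ (x∈⁅x⁆ z))))
      cases : ∀ {u} → u ∈ T → u ≡ x ⊎ u ≡ y ⊎ u ≡ z
      cases m = Sum.map (x∈⁅y⁆⇒x≡y x)
        (Sum.map (x∈⁅y⁆⇒x≡y y) (x∈⁅y⁆⇒x≡y z) ∘ x∈p∪q⁻ ⁅ y ⁆ ⁅ z ⁆) (x∈p∪q⁻ ⁅ x ⁆ (⁅ y ⁆ ∪ ⁅ z ⁆) m)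
      clique-T : IsClique G T
      clique-T u v u∈T v∈T u≢v with cases u∈T | cases v∈T
      ... | inj₁ refl        | inj₁ refl        = contradiction refl u≢v
      ... | inj₁ refl        | inj₂ (inj₁ refl) = xy
      ... | inj₁ refl        | inj₂ (inj₂ refl) = xz
      ... | inj₂ (inj₁ refl) | inj₁ refl        = sym G xy
      ... | inj₂ (inj₁ refl) | inj₂ (inj₁ refl) = contradiction refl u≢v
      ... | inj₂ (inj₁ refl) | inj₂ (inj₂ refl) = yz
      ... | inj₂ (inj₂ refl) | inj₁ refl        = sym G xz
      ... | inj₂ (inj₂ refl) | inj₂ (inj₁ refl) = sym G yz
      ... | inj₂ (inj₂ refl) | inj₂ (inj₂ refl) = contradiction refl u≢v
      T⊆K : T ⊆ K
      T⊆K = clique⊆K n T (m≤n+m n ∣ T ∣) clique-T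
        (3≤∣∣ x∈T y∈T z∈T (λ { refl → irrefl G xy }) (λ { refl → irrefl G xz }) (λ { refl → irrefl G yz }))

  -- Uncovered edges of holes.

  InducedEdge : Subset n → Fin n → Fin n → Set
  InducedEdge S x y = x ∈ S × y ∈ S × Adj G x y

  -- Adj itself need not be decidable, but its restriction to a hole is.
  inducedEdge? : ∀ {S} → IsHole G S → ∀ x y → Dec (InducedEdge S x y)
  inducedEdge? {S} (m , c , _ , _ , mem , adj) x y = map′ to from
    (any? λ i → any? λ j → c i ≟ x ×-dec c j ≟ y ×-dec
      ((toℕ j ≟ⁿ suc (toℕ i) % suc m) ⊎-dec (toℕ i ≟ⁿ suc (toℕ j) % suc m)))
    where
    open Equivalence using () renaming (to to fwd; from to bwd)
    to : (∃[ i ] ∃[ j ] (c i ≡ x × c j ≡ y × CycAdj G m i j)) → InducedEdge S x y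
    to (i , j , refl , refl , a) = bwd (mem _) (i , refl) , bwd (mem _) (j , refl) , bwd (adj i j) a
    from : InducedEdge S x y → ∃[ i ] ∃[ j ] (c i ≡ x × c j ≡ y × CycAdj G m i j)
    from (x∈S , y∈S , a) with fwd (mem _) x∈S | fwd (mem _) y∈S
    ... | i , refl | j , refl = i , j , refl , refl , fwd (adj i j) a

  AllCoveredBut : List (Edge n) → Subset n → Fin n → Fin n → Set
  AllCoveredBut L S x y = InducedEdge S x y × (∀ u v → InducedEdge S u v →
    Covered L u v ⊎ ((u ≡ x × v ≡ y) ⊎ (u ≡ y × v ≡ x)))

  -- As `AllCoveredBut` leaves open whether `xy` itself is covered, this excludes exactly the case
  -- that `S` has a single uncovered edge.
  ClosedAt : List (Edge n) → Subset n → Set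
  ClosedAt L S = ∀ {x y} → AllCoveredBut L S x y → Covered L x y

  allCoveredBut? : ∀ {S} → IsHole G S → ∀ L x y → Dec (AllCoveredBut L S x y)
  allCoveredBut? hole L x y = inducedEdge? hole x y ×-dec
    all? λ u → all? λ v → inducedEdge? hole u v →-dec
      (covered? L u v ⊎-dec ((u ≟ x ×-dec v ≟ y) ⊎-dec (u ≟ y ×-dec v ≟ x)))

  -- Each hole is charged for at most one new edge, since afterwards it is completely covered.
  close-holes : ∀ k (hs : List (Subset n)) → length hs ≡ k → All (IsHole G) hs →
    ∀ L → Edges L → ∃[ L′ ] (Edges L′ × length L′ ≤ k + length L
      × (∀ {e} → e ∈ₗ L → e ∈ₗ L′) × All (ClosedAt L′) hs)
  close-holes k hs len holes L es
    with search (All.map (λ hole → any? λ x → any? λ y → allCoveredBut? hole L x y) holes)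
  -- No hole has an edge passing the test, so all are closed vacuously.
  ... | no ¬a = L , es , m≤n+m _ k , id , All.tabulate λ m b → ⊥-elim (¬a (lose m (_ , _ , b)))
  ... | yes a with Any⇒↭ a
  ...   | S , hs′ , σ , x , y , (x∈S , y∈S , xy) , others
    with k | ≡.trans (≡.sym (↭-length σ)) len | All-resp-↭ σ holes
  ...   | suc k′ | refl | _ ∷ holes′
    with L′ , es′ , len′ , sub , closed ← close-holes k′ hs′ refl holes′ ((x , y) ∷ L) (xy ∷ es) =
      L′ , es′ , ≤-trans len′ (≤-reflexive (+-suc k′ _)) , sub ∘ there ,
      All-resp-↭ (↭-sym σ) ((λ (b , _) → covered _ _ b) ∷ closed)
    where
    covered : ∀ u v → InducedEdge S u v → Covered L′ u v
    covered u v b with others u v b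
    ... | inj₁ c = covered-mono (sub ∘ there) c
    ... | inj₂ (inj₁ (refl , refl)) = inj₂ (inj₁ (sub (here refl)))
    ... | inj₂ (inj₂ (refl , refl)) = inj₂ (inj₂ (sub (here refl)))

  -- Holes from covered geodesics.

  module _ (L : List (Edge n)) (cov⇒adj : ∀ {x y} → Covered L x y → Adj G x y)
           (triangles⊆K : ∀ {x y z} → Adj G x y → Adj G y z → Adj G x z → x ∈ K × z ∈ K)
           (closed : ∀ {S} → IsHole G S → ClosedAt L S) where

    -- A covered geodesic between adjacent x and y closes up to an induced cycle.
    module Cycle {k : ℕ} {x y : Fin n} (p : Path {E = Covered L} k x y) (geo : Geodesic {E = Covered L} k x y)
      (3≤k : 3 ≤ k) (xy : Adj G x y)
      (ih : ∀ {l} → l < k → ∀ {u v} → Path {E = Covered L} l u v → Adj G u v → Covered L u v) where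

      c : Fin (suc k) → Fin n
      c i = at p (toℕ i)

      ≤k : (i : Fin (suc k)) → toℕ i ≤ k
      ≤k = toℕ≤pred[n]

      distinct : ∀ {i j} → i < j → j ≤ k → at p i ≢ at p j
      -- A repeated vertex would give a shortcut of length zero.
      distinct {i} i<j j≤k eq = <⇒≱ i<j
        (≤-trans (geodesic-segment p geo (<⇒≤ i<j) j≤k (subst (Path 0 _) eq [])) (≤-reflexive (+-identityʳ i)))

      injective : Injective _≡_ _≡_ c
      injective {i} {j} eq with <-cmp (toℕ i) (toℕ j)
      ... | tri< lt _ _ = contradiction eq (distinct lt (≤k j))
      ... | tri≈ _ e _ = toℕ-injective e
      ... | tri> _ _ gt = contradiction (≡.sym eq) (distinct gt (≤k i))

      -- If fewer than `k` steps separate the two positions, `ih` makes the chord covered, hence a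
      -- shortcut of length one, and geodesicity leaves only consecutive positions. Otherwise they
      -- are the two ends of the path.
      chord : ∀ {i j} → i < j → j ≤ k → Adj G (at p i) (at p j) → j ≡ suc i ⊎ (j ≡ k × i ≡ 0)
      chord {i} {j} i<j j≤k a with (j ∸ i) <? k
      ... | yes lt = inj₁ (≤-antisym
              (≤-trans (geodesic-segment p geo (<⇒≤ i<j) j≤k (ih lt (segment p (<⇒≤ i<j) j≤k) a ∷ []))
                       (≤-reflexive (+-comm i 1))) i<j)
      ... | no ≥k = inj₂ (≤-antisym j≤k (≤-trans (≮⇒≥ ≥k) (m∸n≤m j i)) , i≡0 i (≮⇒≥ ≥k) i<j)
        where
        i≡0 : ∀ i → k ≤ j ∸ i → i < j → i ≡ 0
        i≡0 zero _ _ = refl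
        i≡0 (suc i) k≤ i<j = contradiction
          (≤-trans k≤ (∸-monoʳ-≤ j (s≤s z≤n)))
          (<⇒≱ (<-≤-trans (pred< i<j) j≤k))
          where
          pred< : ∀ {a b} → a < b → b ∸ 1 < b
          pred< {b = suc b} _ = ≤-refl

      -- Steps of the path are covered by construction; only the wrap-around pair, which is the
      -- closing edge, may be uncovered.
      next-adj : ∀ {i j : Fin (suc k)} → toℕ j ≡ suc (toℕ i) ⊎ (toℕ i ≡ k × toℕ j ≡ 0) →
        Covered L (c i) (c j) ⊎ (c i ≡ y × c j ≡ x)
      next-adj {i} {j} (inj₁ eq) = inj₁ (subst (Covered L (c i)) (cong (at p) (≡.sym eq))
        (at-step p (≤-trans (≤-reflexive (≡.sym eq)) (≤k j))))
      next-adj (inj₂ (i≡k , j≡0)) = inj₂ (≡.trans (cong (at p) i≡k) (at-end p) , cong (at p) j≡0)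

      adj⇒cyc : ∀ i j → Adj G (c i) (c j) → CycAdj G k i j
      adj⇒cyc i j a with <-cmp (toℕ i) (toℕ j)
      ... | tri≈ _ e _ = contradiction (subst (λ t → Adj G (at p t) (c j)) e a) (irrefl G)
      ... | tri< lt _ _ with chord lt (≤k j) a
      ...   | inj₁ e = inj₁ (next⁺ {i = i} {j} (inj₁ e))
      ...   | inj₂ e = inj₂ (next⁺ {i = j} {i} (inj₂ e))
      adj⇒cyc i j a | tri> _ _ gt with chord gt (≤k i) (sym G a)
      ...   | inj₁ e = inj₂ (next⁺ {i = j} {i} (inj₁ e))
      ...   | inj₂ e = inj₁ (next⁺ {i = i} {j} (inj₂ e))

      cyc⇒cov : ∀ i j → CycAdj G k i j → Covered L (c i) (c j) ⊎ ((c i ≡ x × c j ≡ y) ⊎ (c i ≡ y × c j ≡ x))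
      cyc⇒cov i j (inj₁ e) with next-adj {i} {j} (next⁻ e)
      ... | inj₁ h = inj₁ h
      ... | inj₂ (a , b) = inj₂ (inj₂ (a , b))
      cyc⇒cov i j (inj₂ e) with next-adj {j} {i} (next⁻ e)
      ... | inj₁ h = inj₁ (covered-sym h)
      ... | inj₂ (a , b) = inj₂ (inj₁ (b , a))

      cyc⇒adj : ∀ i j → CycAdj G k i j → Adj G (c i) (c j)
      cyc⇒adj i j e with cyc⇒cov i j e
      ... | inj₁ h = cov⇒adj h
      ... | inj₂ (inj₁ (a , b)) = ≡.subst₂ (Adj G) (≡.sym a) (≡.sym b) xy
      ... | inj₂ (inj₂ (a , b)) = ≡.subst₂ (Adj G) (≡.sym a) (≡.sym b) (sym G xy)

      hole : IsHole G (image c)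
      hole = k , c , 3≤k , injective , ∈-image c , λ i j → mk⇔ (adj⇒cyc i j) (cyc⇒adj i j)

      open Equivalence

      conclusion : Covered L x y
      conclusion = closed hole
        ( ( from (∈-image c x) (zero , refl)
          , from (∈-image c y) (fromℕ k , ≡.trans (cong (at p) (toℕ-fromℕ k)) (at-end p))
          , xy )
        , λ u v (u∈ , v∈ , a) → others (to (∈-image c u) u∈) (to (∈-image c v) v∈) a )
        where
        others : ∀ {u v} → ∃[ i ] c i ≡ u → ∃[ j ] c j ≡ v → Adj G u v →
          Covered L u v ⊎ ((u ≡ x × v ≡ y) ⊎ (u ≡ y × v ≡ x))
        others (i , refl) (j , refl) a = cyc⇒cov i j (adj⇒cyc i j a)

    -- Strong induction on the length, because the hole argument needs the result for chords spanned
    -- by shorter segments.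
    adj⇒covered : ∀ k {x y} → Path {E = Covered L} k x y → Adj G x y → Covered L x y
    adj⇒covered = <-rec (λ k → ∀ {x y} → Path k x y → Adj G x y → Covered L x y) step
      where
      step : ∀ k → (∀ {l} → l < k → ∀ {u v} → Path {E = Covered L} l u v → Adj G u v → Covered L u v) →
        ∀ {x y} → Path k x y → Adj G x y → Covered L x y
      -- Decidability of `Covered` permits a search for a shorter path; if there is none, `p` is a
      -- geodesic.
      step k ih {x} {y} p xy with any? (λ (j : Fin k) → path? (covered? L) (toℕ j) x y)
      ... | yes (j , q) = ih (toℕ<n j) q xy
      ... | no ¬shorter = geodesic k ih p xy
              (λ j<k q → ¬shorter (fromℕ< j<k , subst (λ t → Path t x y) (≡.sym (toℕ-fromℕ< j<k)) q))
        where
        geodesic : ∀ k → (∀ {l} → l < k → ∀ {u v} → Path {E = Covered L} l u v → Adj G u v → Covered L u v) →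
          (p : Path {E = Covered L} k x y) → Adj G x y → Geodesic k x y → Covered L x y
        geodesic 0 ih [] xy geo = contradiction xy (irrefl G)
        geodesic 1 ih (e ∷ []) xy geo = e
        -- The path and `xy` form a triangle, so `x` and `y` lie in `K`.
        geodesic 2 ih (e ∷ f ∷ []) xy geo
          with x∈K , y∈K ← triangles⊆K (cov⇒adj e) (cov⇒adj f) xy =
          inj₁ (x∈K , y∈K , λ { refl → irrefl G xy })
        geodesic (suc (suc (suc k))) ih p xy geo =
          Cycle.conclusion p geo (s≤s (s≤s (s≤s z≤n))) xy ih

  -- Spanning the graph from the clique and counting edges.

  crossing : ∀ {x y} (R : Subset n) → Star (Adj G) x y → x ∈ R → y ∉ R →
    ∃[ u ] ∃[ w ] (u ∈ R × w ∉ R × Adj G u w)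
  crossing R ε x∈R y∉R = contradiction x∈R y∉R
  crossing R (_◅_ {j = z} e s) x∈R y∉R with z ∈? R
  ... | yes z∈R = crossing R s z∈R y∉R
  ... | no  z∉R = _ , _ , x∈R , z∉R , e

  -- The reached set `R`, started at `K`, gains one vertex per added edge, which preserves the bound
  -- on `length L`. The number `d` bounds the vertices still missing.
  spanning-edges : Connected G → ∀ d (r : Fin n) (R : Subset n) (L : List (Edge n)) →
    r ∈ R → n ≤ ∣ R ∣ + d → length L + ∣ K ∣ ≤ ∣ R ∣ → Edges L → (∀ x → x ∈ R → Star (Covered L) r x) →
    ∃[ L′ ] (length L′ + ∣ K ∣ ≤ n × Edges L′ × (∀ x → Star (Covered L′) r x))
  spanning-edges conn d r R L r∈R n≤ size es reach with any? (λ x → ¬? (x ∈? R))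
  ... | no all = L , ≤-trans size (∣p∣≤n R) , es , λ x → reach x (inR x)
    where
    inR : ∀ x → x ∈ R
    inR x with x ∈? R
    ... | yes m = m
    ... | no ¬m = contradiction (x , ¬m) all
  ... | yes (y , y∉R) with u , w , u∈R , w∉R , uw ← crossing R (conn r y) r∈R y∉R = grow d n≤
    where
    R′ : Subset n
    R′ = R ∪ ⁅ w ⁆
    bigger : ∣ R ∣ < ∣ R′ ∣
    bigger = p⊂q⇒∣p∣<∣q∣ (p⊆p∪q ⁅ w ⁆ , w , x∈p∪q⁺ {p = R} (inj₂ (x∈⁅x⁆ w)) , w∉R)
    reach′ : ∀ x → x ∈ R′ → Star (Covered ((u , w) ∷ L)) r x
    reach′ x m with x∈p∪q⁻ R ⁅ w ⁆ m
    ... | inj₁ x∈R = Star.map (covered-mono there) (reach x x∈R)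
    ... | inj₂ x∈w rewrite x∈⁅y⁆⇒x≡y w x∈w =
      Star.map (covered-mono there) (reach u u∈R) ◅◅ (inj₂ (inj₁ (here refl)) ◅ ε)
    grow : ∀ d → n ≤ ∣ R ∣ + d → ∃[ L′ ] (length L′ + ∣ K ∣ ≤ n × Edges L′ × (∀ x → Star (Covered L′) r x))
    grow zero n≤ = ⊥-elim (<-irrefl refl (<-≤-trans bigger
      (≤-trans (∣p∣≤n R′) (≤-trans n≤ (≤-reflexive (+-identityʳ _))))))
    grow (suc d) n≤ = spanning-edges conn d r R′ ((u , w) ∷ L) (p⊆p∪q ⁅ w ⁆ r∈R)
      (≤-trans n≤ (≤-trans (≤-reflexive (+-suc _ d)) (+-monoˡ-≤ d bigger)))
      (≤-trans (s≤s size) bigger) (uw ∷ es) reach′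

nonempty : (K : Subset n) {k : ℕ} → ∣ K ∣ ≡ suc k → Nonempty K
nonempty {n} K eq with nonempty? K
... | yes ne = ne
... | no  em with () ← ≡.trans (≡.sym eq) (≡.trans (cong ∣_∣ (Empty-unique em)) (∣⊥∣≡0 n))

-- Spanning costs at most n - (h + 1) edges and closing the holes at most h more, which leaves at
-- most n - 1.
edge-cover : ∀ {h} (G : Graph n) → Connected G → HasExactlyHoles G h →
  AtMostOneNonEdgeMaximalClique G → (∀ T → IsClique G T → ∣ T ∣ ≤ suc h) →
  (K : Subset n) → IsClique G K → ∣ K ∣ ≡ suc h →
  ∃[ L ] (suc (length L) ≤ n × Edges G K L × (∀ {x y} → Adj G x y → Covered G K L x y))
edge-cover {n} {h} G conn (hs , _ , len , holes , all-holes) unique-max bound K clique-K ∣K∣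
  with r , r∈K ← nonempty K ∣K∣
  with L₀ , size₀ , es₀ , reach₀ ← spanning-edges G K conn n r K [] r∈K (m≤n+m n ∣ K ∣) ≤-refl []
         (λ x → K-connected G K r∈K)
  with L , es , size , sub , closed ← close-holes G K h hs len holes L₀ es₀ =
  L , small , es , λ {x} {y} a → let k , p = path x y in
    adj⇒covered G K L (covered⇒adj G K clique-K es)
      (triangle⊆K G K clique-K (λ T c → ≤-trans (bound T c) (≤-reflexive (≡.sym ∣K∣))) unique-max)
      (λ {S} hole → All.lookup closed (all-holes S hole)) k p a
  where
  path : ∀ x y → ∃[ k ] Path {E = Covered G K L} k x y
  path x y = Star⇒Path (Star.map (covered-mono G K sub)
    (Star.reverse (covered-sym G K) (reach₀ x) ◅◅ reach₀ y))
  small : suc (length L) ≤ n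
  small = begin
    suc (length L)          ≤⟨ s≤s size ⟩
    suc (h + length L₀)     ≡⟨ +-comm (suc h) (length L₀) ⟩
    length L₀ + suc h       ≡⟨ cong (length L₀ +_) (≡.sym ∣K∣) ⟩
    length L₀ + ∣ K ∣       ≤⟨ size₀ ⟩
    n                       ∎
    where open ≤-Reasoning

-- The digraph.

ranked⇒acyclic : ∀ {N} {Arc : Fin N → Fin N → Set} (rank : Fin N → ℕ) →
  (∀ {x y} → Arc x y → rank y < rank x) → Acyclic Arc
ranked⇒acyclic {Arc = Arc} rank dec x c = <-irrefl refl (dec⁺ c)
  where
  dec⁺ : ∀ {x y} → TransClosure Arc x y → rank y < rank x
  dec⁺ [ a ] = dec a
  dec⁺ (a ∷ c) = <-trans (dec⁺ c) (dec a)

-- i₂ is reserved for K, so it is not a Prey.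
preyOf : Fin n ⊎ Fin 2 → Maybe (Prey n)
preyOf (inj₁ x) = just (just x)
preyOf (inj₂ zero) = just nothing
preyOf (inj₂ (suc zero)) = nothing

vertexOf : Prey n → Fin (n + 2)
vertexOf (just x) = x ↑ˡ 2
vertexOf {n} nothing = n ↑ʳ zero

preyOf-vertexOf : (p : Prey n) → preyOf (splitAt n (vertexOf p)) ≡ just p
preyOf-vertexOf {n} (just x) = cong preyOf (splitAt-↑ˡ n x 2)
preyOf-vertexOf {n} nothing = cong preyOf (splitAt-↑ʳ n 2 zero)

module CompetitionDigraph (G : Graph n) (K : Subset n) (clique-K : IsClique G K)
  (L : List (Edge n)) (edges : Edges G K L) (adj⇒cov : ∀ {x y} → Adj G x y → Covered G K L x y)
  (assignment : PreyAssignment (allFin n) L (nothing ∷ [])) where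
  open PreyAssignment assignment

  -- Of the two layers of `Maybe`, the outer `nothing` is i₂ and `just nothing` is i₁.
  PreysOn : Fin n → Maybe (Prey n) → Set
  PreysOn x nothing  = x ∈ K
  PreysOn x (just p) = ∃[ e ] (owner p ≡ just e × Incident x e)

  -- Every tail is a copy of a vertex of `G`, so i₁ and i₂ have no out-neighbors and stay isolated
  -- in the competition graph.
  Arc : Fin (n + 2) → Fin (n + 2) → Set
  Arc X Y = ∃[ x ] (X ≡ x ↑ˡ 2 × PreysOn x (preyOf (splitAt n Y)))

  vertexRank : Fin n ⊎ Fin 2 → ℕ
  vertexRank = [ rank , (λ _ → 0) ]′

  preysOn-rank : ∀ x s → PreysOn x (preyOf s) → vertexRank s < rank x
  preysOn-rank x (inj₁ y) (_ , eq , i) = decreasing eq i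
  preysOn-rank x (inj₂ _) _ = rank-pos (∈-allFin x)

  arc-rank : ∀ {X Y} → Arc X Y → vertexRank (splitAt n Y) < vertexRank (splitAt n X)
  arc-rank {Y = Y} (x , refl , h) rewrite splitAt-↑ˡ n x 2 = preysOn-rank x (splitAt n Y) h

  acyclic : Acyclic Arc
  acyclic = ranked⇒acyclic (vertexRank ∘ splitAt n) (λ {X} {Y} → arc-rank {X} {Y})

  K-arc : ∀ x → x ∈ K → Arc (x ↑ˡ 2) (n ↑ʳ suc zero)
  K-arc x x∈K = x , refl , subst (PreysOn x) (≡.sym (cong preyOf (splitAt-↑ʳ n 2 (suc zero)))) x∈K

  edge-arc : ∀ {x p e} → owner p ≡ just e → Incident x e → Arc (x ↑ˡ 2) (vertexOf p)
  edge-arc {x} {p} eq i = x , refl , subst (PreysOn x) (≡.sym (preyOf-vertexOf p)) (_ , eq , i)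

  incident⇒adj : ∀ {x y e} → e ∈ₗ L → Incident x e → Incident y e → x ≢ y → Adj G x y
  incident⇒adj m (inj₁ refl) (inj₁ refl) x≢y = contradiction refl x≢y
  incident⇒adj m (inj₁ refl) (inj₂ refl) x≢y = All.lookup edges m
  incident⇒adj m (inj₂ refl) (inj₁ refl) x≢y = sym G (All.lookup edges m)
  incident⇒adj m (inj₂ refl) (inj₂ refl) x≢y = contradiction refl x≢y

  -- A prey has a single owner, so two vertices sharing it are the ends of one edge; sharing i₂
  -- means that both lie in the clique.
  common⇒adj : ∀ {x y} q → PreysOn x q → PreysOn y q → x ≢ y → Adj G x y
  common⇒adj nothing x∈K y∈K x≢y = clique-K _ _ x∈K y∈K x≢y
  common⇒adj (just p) (e , eq , i) (f , eq′ , j) x≢y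
    with refl ← just-injective (≡.trans (≡.sym eq) eq′) = incident⇒adj (owner-∈ eq) i j x≢y

  adj⇒common : ∀ {x y} → Adj G x y → ∃[ Z ] (Arc (x ↑ˡ 2) Z × Arc (y ↑ˡ 2) Z)
  adj⇒common a with adj⇒cov a
  ... | inj₁ (x∈K , y∈K , _) = _ , K-arc _ x∈K , K-arc _ y∈K
  ... | inj₂ (inj₁ m) with p , eq ← total m = _ , edge-arc eq (inj₁ refl) , edge-arc eq (inj₂ refl)
  ... | inj₂ (inj₂ m) with p , eq ← total m = _ , edge-arc eq (inj₂ refl) , edge-arc eq (inj₁ refl)

  isCompetitionGraph : IsCompetitionGraphOf (ExtAdj G 2) Arc
  isCompetitionGraph X Y X≢Y = mk⇔ to from
    where
    to : ExtAdj G 2 X Y → ∃[ Z ] (Arc X Z × Arc Y Z)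
    to a with splitAt n X in eqX | splitAt n Y in eqY
    ... | inj₁ x | inj₁ y
      with refl ← splitAt⁻¹-↑ˡ eqX | refl ← splitAt⁻¹-↑ˡ eqY = adj⇒common a
    from : ∃[ Z ] (Arc X Z × Arc Y Z) → ExtAdj G 2 X Y
    from (Z , (x , refl , hx) , (y , refl , hy)) rewrite splitAt-↑ˡ n x 2 | splitAt-↑ˡ n y 2 =
      common⇒adj (preyOf (splitAt n Z)) hx hy (λ { refl → X≢Y refl })

theorem2p6 : (n h : ℕ) (G : Graph n) → Connected G → HasExactlyHoles G h
    → HolesPairwiseEdgeDisjoint G → AtMostOneNonEdgeMaximalClique G
    → CliqueNumber≡ G (suc h)
    → (K : Subset n) → IsClique G K → ∣ K ∣ ≡ suc h
    → Σ (Fin (n + 2) → Fin (n + 2) → Set) (λ Arc →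
    Acyclic Arc × IsCompetitionGraphOf (ExtAdj G 2) Arc
    × (∀ x → x ∈ K → Arc (x ↑ˡ 2) (n ↑ʳ suc zero)))
    × CompetitionNumber≤ G 2
theorem2p6 n h G conn holes _ unique-max (_ , bound) K clique-K ∣K∣
  with L , small , edges , adj⇒cov ← edge-cover G conn holes unique-max bound K clique-K ∣K∣ =
  (Arc , acyclic , isCompetitionGraph , K-arc) , 2 , ≤-refl , Arc , acyclic , isCompetitionGraph
  where
  n≡ : length (allFin n) ≡ n
  n≡ = length-tabulate id
  -- Initially i₁ is the only prey, so the bound to meet is `length L` ≤ n - 1.
  sparse : length L + 2 ≤ length (allFin n) + 1
  sparse = ≤-trans (≤-reflexive (+-suc (length L) 1))
    (≤-trans (+-monoˡ-≤ 1 small) (≤-reflexive (cong (_+ 1) (≡.sym n≡))))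
  assignment : PreyAssignment (allFin n) L (nothing ∷ [])
  assignment = assign-preys n (allFin n) L (nothing ∷ []) (≤-reflexive n≡) (allFin⁺ n) ([] ∷ [])
    (λ { (here refl) m → case ∈-map⁻ just m of λ () })
    (λ _ {x} _ → ∈-allFin x)
    (λ m eq → irrefl G (subst (Adj G _) (≡.sym eq) (All.lookup edges m)))
    ≤-refl sparse
  open CompetitionDigraph G K clique-K L edges adj⇒cov assignment
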